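{- Let $V$ be a finite-dimensional real vector space and $X\subseteq V$ a finite or countable set in which every $2$-dimensional linear subset has fundamental vectors, equipped with a suitable ordering. Then the subsets of $X$ that are biclosed in $X$ form a complete lattice under containment. More specifically, for any collection $\mathcal{X}$ of biclosed subsets of $X$, \[\bigvee_{Y\in\mathcal{X}}Y=\overline{\bigcup_{Y\in\mathcal{X}}Y},\qquad \bigwedge_{Y\in\mathcal{X}}Y=\Big(\bigcap_{Y\in\mathcal{X}}Y\Big)^{\circ}.\]
   Context: $\mathrm{Span}_+$ denotes nonnegative linear combinations. For $Y\subseteq X$, $B\subseteq Y$: closed in $Y$ if $\alpha,\beta\in B$, $\gamma\in\mathrm{Span}_+(\alpha,\beta)\cap Y$ imply $\gamma\in B$; coclosed if $Y\setminus B$ closed; biclosed if both; weakly separable if $\mathrm{Span}_+(B)\cap\mathrm{Span}_+(Y\setminus B)=\{0\}$; $Y$ is clean if every biclosed subset of $Y$ is weakly separable in $Y$. $\overline{A}$ denotes the closure of $A$ in $X$ (smallest closed subset of $X$ containing $A$) and $A^\circ=X\setminus\overline{X\setminus A}$ the interior (largest coclosed subset of $X$ contained in $A$). A linear subset is $X\cap L$ for a subspace $L$. A $2$-dimensional linear subset $Y$ has fundamental vectors $\alpha,\beta\in Y$ if $Y\subseteq\mathrm{Span}_+\{\alpha,\beta\}$ and neither $\alpha$ nor $\beta$ lies in the nonnegative span of the other elements of $Y$. $F\subseteq X$ is full if $F\cap\mathrm{Span}\{\alpha,\beta\}=X\cap\mathrm{Span}\{\alpha,\beta\}$ for all $\alpha,\beta\in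 F$. An ordering $\gamma_1,\gamma_2,\ldots$ of $X$ with initial segments $X_i=\{\gamma_1,\dots,\gamma_i\}$ is suitable if (1) in every $2$-dimensional linear subset the fundamental vectors precede all its other vectors, and (2) for every $i$ and $\alpha,\beta,\gamma\in X_i$ there is a full $F\subseteq X$ containing them with $F\cap X_i$ clean. -}

module Defs where

open import Level using (Level; _⊔_; suc)
open import Algebra.Bundles using (CommutativeRing)
open import Algebra.Module.Bundles using (Module)
import Algebra.Definitions.RawMonoid as RawMonoidDefs
open import Data.Fin.Base using (Fin; toℕ)
open import Data.Nat.Base as ℕ using (ℕ)
open import Data.Product using (Σ-syntax; ∃; ∃-syntax; _×_; _,_)
open import Data.Vec.Functional using (Vector)
open import Relation.Binary.Bundles using (Poset)
import Relation.Binary.Construct.On as On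
open import Relation.Binary.Core using (Rel)
open import Relation.Binary.Definitions using (_Respects_)
open import Relation.Binary.PropositionalEquality using (_≡_)
open import Relation.Binary.Structures using (IsTotalOrder)
open import Relation.Nullary using (¬_)
open import Relation.Unary using (Pred; _∈_; _⊆_; _≐_; _∩_; _∖_; U)
open import Relation.Unary.Relation.Binary.Subset using (⊆-poset)

private
  variable
    c ℓ₁ ℓ₂ a s : Level

module _ (P : Poset c ℓ₁ ℓ₂) where
  open Poset P

  IsJoin : Pred Carrier s → Carrier → Set (c ⊔ ℓ₂ ⊔ s)
  IsJoin S x = (∀ y → y ∈ S → y ≤ x) × (∀ z → (∀ y → y ∈ S → y ≤ z) → x ≤ z)

  IsMeet : Pred Carrier s → Carrier → Set (c ⊔ ℓ₂ ⊔ s)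
  IsMeet S x = (∀ y → y ∈ S → x ≤ y) × (∀ z → (∀ y → y ∈ S → z ≤ y) → z ≤ x)

  IsCompleteLattice : Set (suc c ⊔ ℓ₂)
  IsCompleteLattice = (S : Pred Carrier c) → ∃ (IsJoin S) × ∃ (IsMeet S)

-- The real numbers, characterised (classically, up to unique isomorphism) as
-- a Dedekind-complete ordered field.
record RealField ℓ : Set (suc ℓ) where
  infix 4 _≤_
  field
    commutativeRing : CommutativeRing ℓ ℓ
  open CommutativeRing commutativeRing public
  field
    _≤_          : Rel Carrier ℓ
    isTotalOrder : IsTotalOrder _≈_ _≤_
    0≉1          : ¬ (0# ≈ 1#)
    inverse      : ∀ x → ¬ (x ≈ 0#) → ∃[ y ] x * y ≈ 1#
    +-monoˡ-≤    : ∀ z {x y} → x ≤ y → x + z ≤ y + z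
    *-nonNeg     : ∀ {x y} → 0# ≤ x → 0# ≤ y → 0# ≤ x * y
    supremum     : (S : Pred Carrier ℓ) → ∃ S →
                   (∃[ b ] (∀ x → x ∈ S → x ≤ b)) →
                   ∃[ m ] ((∀ x → x ∈ S → x ≤ m) ×
                           (∀ b → (∀ x → x ∈ S → x ≤ b) → m ≤ b))

VectorSpace : ∀ {ℓ} → RealField ℓ → Set (suc ℓ)
VectorSpace {ℓ} ℝ = Module (RealField.commutativeRing ℝ) ℓ ℓ

-- The length of a finite or infinite sequence.
data Length : Set where
  finite   : ℕ → Length
  infinite : Length

Index : Length → Set
Index (finite n) = Fin n
Index infinite   = ℕ

position : ∀ {l} → Index l → ℕ
position {finite n} i = toℕ i
position {infinite} i = i

module Geometry {ℓ} (ℝ : RealField ℓ) (V : VectorSpace ℝ) where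
  open RealField ℝ using (Carrier; 0#; _≤_; _≈_)
  open Module V using (Carrierᴹ; _≈ᴹ_; _+ᴹ_; _*ₗ_; 0ᴹ; +ᴹ-rawMonoid)
  open RawMonoidDefs +ᴹ-rawMonoid using (sum)

  combination : ∀ {n} → Vector Carrier n → Vector Carrierᴹ n → Carrierᴹ
  combination k v = sum (λ i → k i *ₗ v i)

  Span : Pred Carrierᴹ ℓ → Pred Carrierᴹ ℓ
  Span S x = Σ[ n ∈ ℕ ] Σ[ k ∈ Vector Carrier n ] Σ[ v ∈ Vector Carrierᴹ n ]
    (∀ i → v i ∈ S) × x ≈ᴹ combination k v

  Span₊ : Pred Carrierᴹ ℓ → Pred Carrierᴹ ℓ
  Span₊ S x = Σ[ n ∈ ℕ ] Σ[ k ∈ Vector Carrier n ] Σ[ v ∈ Vector Carrierᴹ n ]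
    (∀ i → 0# ≤ k i) × (∀ i → v i ∈ S) × x ≈ᴹ combination k v

  data ⟅_,_⟆ (α β : Carrierᴹ) : Pred Carrierᴹ ℓ where
    first  : ∀ {x} → x ≈ᴹ α → x ∈ ⟅ α , β ⟆
    second : ∀ {x} → x ≈ᴹ β → x ∈ ⟅ α , β ⟆

  LinearlyIndependent : ∀ {n} → Vector Carrierᴹ n → Set ℓ
  LinearlyIndependent b = ∀ k → combination k b ≈ᴹ 0ᴹ → ∀ i → k i ≈ 0#

  HasDimension : ∀ {s} → ℕ → Pred Carrierᴹ s → Set (ℓ ⊔ s)
  HasDimension n S = Σ[ b ∈ Vector Carrierᴹ n ]
    LinearlyIndependent b × Span (λ x → ∃[ i ] x ≈ᴹ b i) ≐ S

  FiniteDimensional : Set ℓ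
  FiniteDimensional = ∃[ n ] HasDimension n U

  record IsSubspace (L : Pred Carrierᴹ ℓ) : Set ℓ where
    field
      respects : L Respects _≈ᴹ_
      zero-∈   : 0ᴹ ∈ L
      +-∈      : ∀ {x y} → x ∈ L → y ∈ L → x +ᴹ y ∈ L
      *-∈      : ∀ k {x} → x ∈ L → k *ₗ x ∈ L

  ClosedIn : ∀ {a} → Pred Carrierᴹ ℓ → Pred Carrierᴹ a → Set (ℓ ⊔ a)
  ClosedIn Y B = ∀ {α β γ} → α ∈ B → β ∈ B → γ ∈ Span₊ ⟅ α , β ⟆ ∩ Y → γ ∈ B

  -- No compatibility with _≈ᴹ_ is demanded of B: it follows from closedness
  -- whenever Y has it, because α′ ≈ᴹ α implies α′ ∈ Span₊ ⟅ α , α ⟆.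
  record BiclosedIn (Y B : Pred Carrierᴹ ℓ) : Set ℓ where
    field
      contained : B ⊆ Y
      closed    : ClosedIn Y B
      coclosed  : ClosedIn Y (Y ∖ B)

  WeaklySeparable : Pred Carrierᴹ ℓ → Pred Carrierᴹ ℓ → Set ℓ
  WeaklySeparable Y B = Span₊ B ∩ Span₊ (Y ∖ B) ≐ (_≈ᴹ 0ᴹ)

  Clean : Pred Carrierᴹ ℓ → Set (suc ℓ)
  Clean Y = ∀ B → BiclosedIn Y B → WeaklySeparable Y B

  FundamentalVectors : Pred Carrierᴹ ℓ → Carrierᴹ → Carrierᴹ → Set ℓ
  FundamentalVectors Y α β =
    α ∈ Y × β ∈ Y × Y ⊆ Span₊ ⟅ α , β ⟆ ×
    ¬ (α ∈ Span₊ (Y ∖ (_≈ᴹ α))) × ¬ (β ∈ Span₊ (Y ∖ (_≈ᴹ β)))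

  module _ (X : Pred Carrierᴹ ℓ) where

    -- The smallest subset closed in X that contains A (for A ⊆ X), as shown
    -- by closure-closed and closure-least.
    data Closure {a} (A : Pred Carrierᴹ a) : Pred Carrierᴹ (ℓ ⊔ a) where
      include  : A ⊆ Closure A
      generate : ∀ {α β γ} → α ∈ Closure A → β ∈ Closure A →
                 γ ∈ Span₊ ⟅ α , β ⟆ → γ ∈ X → γ ∈ Closure A

    closure-closed : (A : Pred Carrierᴹ a) → ClosedIn X (Closure A)
    closure-closed A p q (r , x) = generate p q r x

    closure-least : (A : Pred Carrierᴹ a) (B : Pred Carrierᴹ s) →
                    A ⊆ B → ClosedIn X B → Closure A ⊆ B
    closure-least A B A⊆B cl (include x)          = A⊆B x
    closure-least A B A⊆B cl (generate p q r x) =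
      cl (closure-least A B A⊆B cl p) (closure-least A B A⊆B cl q) (r , x)

    Interior : ∀ {a} → Pred Carrierᴹ a → Pred Carrierᴹ (ℓ ⊔ a)
    Interior A = X ∖ Closure (X ∖ A)

    LinearSubset : Pred Carrierᴹ ℓ → Set (suc ℓ)
    LinearSubset Y = ∃[ L ] IsSubspace L × Y ≐ X ∩ L

    -- The dimension of a linear subset is that of its linear span.
    TwoDimensionalLinearSubset : Pred Carrierᴹ ℓ → Set (suc ℓ)
    TwoDimensionalLinearSubset Y = LinearSubset Y × HasDimension 2 (Span Y)

    HasAllFundamentalVectors : Set (suc ℓ)
    HasAllFundamentalVectors =
      ∀ Y → TwoDimensionalLinearSubset Y → ∃[ α ] ∃[ β ] FundamentalVectors Y α β

    record Full (F : Pred Carrierᴹ ℓ) : Set ℓ where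
      field
        contained : F ⊆ X
        full      : ∀ {α β} → α ∈ F → β ∈ F →
                    F ∩ Span ⟅ α , β ⟆ ≐ X ∩ Span ⟅ α , β ⟆

    -- An enumeration of X without repetition, indexed from 0; its existence
    -- says that X is finite or countable.
    record Ordering : Set ℓ where
      field
        length     : Length
        vector     : Index length → Carrierᴹ
        member     : ∀ i → vector i ∈ X
        injective  : ∀ {i j} → vector i ≈ᴹ vector j → i ≡ j
        surjective : ∀ {x} → x ∈ X → ∃[ i ] x ≈ᴹ vector i

      _precedes_ : Rel Carrierᴹ ℓ
      x precedes y = ∃[ i ] ∃[ j ]
        x ≈ᴹ vector i × y ≈ᴹ vector j × position i ℕ.< position j

      -- The first n elements, or all of X if there are fewer than n.
      segment : ℕ → Pred Carrierᴹ ℓ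
      segment n x = ∃[ i ] x ≈ᴹ vector i × position i ℕ.< n

    record Suitable (order : Ordering) : Set (suc ℓ) where
      open Ordering order
      field
        fundamental-first :
          ∀ Y → TwoDimensionalLinearSubset Y →
          ∀ {α β} → FundamentalVectors Y α β →
          ∀ {γ} → γ ∈ Y → ¬ (γ ≈ᴹ α) → ¬ (γ ≈ᴹ β) →
          α precedes γ × β precedes γ
        locally-clean :
          ∀ n {α β γ} → α ∈ segment n → β ∈ segment n → γ ∈ segment n →
          ∃[ F ] Full F × α ∈ F × β ∈ F × γ ∈ F × Clean (F ∩ segment n)

    BiclosedSubset : Set (suc ℓ)
    BiclosedSubset = ∃ (BiclosedIn X)

    ⟦_⟧ : BiclosedSubset → Pred Carrierᴹ ℓ
    ⟦ B , _ ⟧ = B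

    biclosedPoset : Poset (suc ℓ) ℓ ℓ
    biclosedPoset = On.poset (⊆-poset Carrierᴹ ℓ) ⟦_⟧

    Union : Pred BiclosedSubset (suc ℓ) → Pred Carrierᴹ (suc ℓ)
    Union 𝒳 x = ∃[ Y ] Y ∈ 𝒳 × x ∈ ⟦ Y ⟧

    -- Taken within X, so that the empty intersection is X.
    Intersection : Pred BiclosedSubset (suc ℓ) → Pred Carrierᴹ (suc ℓ)
    Intersection 𝒳 x = x ∈ X × (∀ Y → Y ∈ 𝒳 → x ∈ ⟦ Y ⟧)

{-# OPTIONS --safe #-}
module Submission where

-- Add the elements of X one at a time, in the given order.  Let A be coclosed (such as a
-- union of biclosed sets), and let 0 ∉ X.  Put C₀ = ∅ and let
-- Cₙ₊₁ contain the next element γ if γ ∈ A or γ ∈ Span₊(μ, ν) for some μ, ν ∈ Cₙ.  By induction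
-- Cₙ is biclosed in the n-th initial segment, so that ⋃ Cₙ is the closure of A and is coclosed.
-- Two facts carry the induction step.  Cleanness of a full set containing μ, ν and α shows that
-- γ cannot lie both in Span₊(μ, ν) with μ, ν ∈ Cₙ and in Span₊(α, β) with α, β ∉ Cₙ.  And if old
-- elements δ, ε satisfy ε ∈ Span₊(γ, δ), then γ is not fundamental in their plane (apart from
-- degenerate cases), so a fundamental vector α of that plane is old and lies on the far side of
-- γ: γ ∈ Span₊(α, ε) and ε ∈ Span₊(α, δ).  Meets follow by taking complements.

open import Level using (suc; Lift; lift; lower)
open import Algebra.Module.Bundles using (Module)
open import Axiom.ExcludedMiddle using (ExcludedMiddle)
open import Data.Empty using (⊥-elim)
open import Data.Empty.Polymorphic using (⊥)
import Data.Fin.Base as Fin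
open import Data.Fin.Properties using (toℕ-injective)
open import Data.Nat.Base as ℕ using (ℕ)
import Data.Nat.Properties as ℕ
open import Data.Product using (∃; ∃-syntax; _×_; _,_; proj₁; proj₂)
open import Data.Sum using (_⊎_; inj₁; inj₂; [_,_]′)
open import Data.Vec.Functional using (Vector; []; _∷_)
open import Function using (_∘_; id)
open import Relation.Binary.Definitions using (_Respects_)
open import Relation.Binary.PropositionalEquality as ≡ using (_≡_)
open import Relation.Binary.Structures using (IsTotalOrder)
open import Relation.Nullary using (¬_; yes; no)
open import Relation.Nullary.Decidable using (True; fromWitness; toWitness; map′; decidable-stable)
open import Relation.Unary using (Pred; _∈_; _∉_; _⊆_; _≐_; _∩_; _∪_; _∖_)
open import Relation.Unary.Properties using (≐-refl)
open import Defs

module OrderedField {ℓ} (ℝ : RealField ℓ) where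
  open RealField ℝ
  open IsTotalOrder isTotalOrder public
    using (total; antisym; ≤-respˡ-≈; ≤-respʳ-≈)
    renaming (refl to ≤-refl; trans to ≤-trans)
  open import Algebra.Properties.Ring ring using (-1*x≈-x; -‿distribʳ-*; -‿involutive)
  open import Relation.Binary.Reasoning.Setoid setoid

  NonNeg : Pred Carrier ℓ
  NonNeg x = 0# ≤ x

  +-nonNeg : ∀ {x y} → NonNeg x → NonNeg y → NonNeg (x + y)
  +-nonNeg {x} {y} p q = ≤-trans q (≤-respˡ-≈ (+-identityˡ y) (+-monoˡ-≤ y p))

  difference : ∀ {x y} → x ≤ y → ∃[ d ] NonNeg d × y ≈ x + d
  difference {x} {y} x≤y = y - x , ≤-respˡ-≈ (-‿inverseʳ x) (+-monoˡ-≤ (- x) x≤y) , sym (begin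
    x + (y - x)   ≈⟨ +-congˡ (+-comm y (- x)) ⟩
    x + (- x + y) ≈⟨ +-assoc x (- x) y ⟨
    x - x + y     ≈⟨ +-congʳ (-‿inverseʳ x) ⟩
    0# + y        ≈⟨ +-identityˡ y ⟩
    y             ∎)

  nonPos⇒-nonNeg : ∀ {x} → x ≤ 0# → NonNeg (- x)
  nonPos⇒-nonNeg {x} x≤0 =
    ≤-respˡ-≈ (-‿inverseʳ x) (≤-respʳ-≈ (+-identityˡ (- x)) (+-monoˡ-≤ (- x) x≤0))

  0≤1 : NonNeg 1#
  0≤1 with total 0# 1#
  ... | inj₁ p = p
  ... | inj₂ p = ≤-respʳ-≈ (trans (-1*x≈-x (- 1#)) (-‿involutive 1#)) (*-nonNeg q q)
    where q = nonPos⇒-nonNeg p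

  0≰-1 : ¬ NonNeg (- 1#)
  0≰-1 p = 0≉1 (antisym 0≤1
    (≤-respˡ-≈ (+-identityˡ 1#) (≤-respʳ-≈ (-‿inverseˡ 1#) (+-monoˡ-≤ 1# p))))

  inverse-nonNeg : ∀ {x} → NonNeg x → ¬ (x ≈ 0#) → ∃[ y ] NonNeg y × y * x ≈ 1#
  inverse-nonNeg {x} 0≤x x≉0 with inverse x x≉0
  ... | y , xy≈1 with total 0# y
  ...   | inj₁ 0≤y = y , 0≤y , trans (*-comm y x) xy≈1
  ...   | inj₂ y≤0 = ⊥-elim (0≰-1 (≤-respʳ-≈
    (trans (sym (-‿distribʳ-* x y)) (-‿cong xy≈1)) (*-nonNeg 0≤x (nonPos⇒-nonNeg y≤0))))

  x*y≈0⇒y≈0 : ∀ {x y} → ¬ (x ≈ 0#) → x * y ≈ 0# → y ≈ 0#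
  x*y≈0⇒y≈0 {x} {y} x≉0 xy≈0 with inverse x x≉0
  ... | z , xz≈1 = begin
    y           ≈⟨ *-identityˡ y ⟨
    1# * y      ≈⟨ *-congʳ xz≈1 ⟨
    x * z * y   ≈⟨ *-congʳ (*-comm x z) ⟩
    z * x * y   ≈⟨ *-assoc z x y ⟩
    z * (x * y) ≈⟨ *-congˡ xy≈0 ⟩
    z * 0#      ≈⟨ zeroʳ z ⟩
    0#          ∎

  nonNeg-sum-zeroʳ : ∀ {x y} → NonNeg x → NonNeg y → x + y ≈ 0# → y ≈ 0#
  nonNeg-sum-zeroʳ {x} {y} p q e =
    antisym (≤-respˡ-≈ (+-identityˡ y) (≤-respʳ-≈ e (+-monoˡ-≤ y p))) q

module Cones {ℓ} (ℝ : RealField ℓ) (V : VectorSpace ℝ) where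
  open RealField ℝ
  open Module V
  open Geometry ℝ V
  open OrderedField ℝ
  open import Algebra.Module.Properties V using (x≈0⇒x*y≈0)
  open import Algebra.Solver.Ring.NaturalCoefficients.Default commutativeSemiring
    using (solve; _:=_; _:+_; _:*_; con)
  open import Algebra.Bundles using (module CommutativeMonoid)
  open import Algebra.Properties.CommutativeSemigroup
    (CommutativeMonoid.commutativeSemigroup +ᴹ-commutativeMonoid)
    using (interchange)

  lin : Carrierᴹ → Carrierᴹ → Carrier → Carrier → Carrierᴹ
  lin α β a b = a *ₗ α +ᴹ b *ₗ β

  Cone : Carrierᴹ → Carrierᴹ → Pred Carrierᴹ ℓ
  Cone α β x = ∃[ a ] ∃[ b ] NonNeg a × NonNeg b × x ≈ᴹ lin α β a b

  Plane : Carrierᴹ → Carrierᴹ → Pred Carrierᴹ ℓ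
  Plane α β x = ∃[ a ] ∃[ b ] x ≈ᴹ lin α β a b

  *ₗ-cancelˡ : ∀ {z k x y} → z * k ≈ 1# → k *ₗ x ≈ᴹ y → x ≈ᴹ z *ₗ y
  *ₗ-cancelˡ {z} {k} {x} {y} zk≈1 e = begin
    x             ≈⟨ *ₗ-identityˡ x ⟨
    1# *ₗ x       ≈⟨ *ₗ-congʳ zk≈1 ⟨
    (z * k) *ₗ x  ≈⟨ *ₗ-assoc z k x ⟩
    z *ₗ (k *ₗ x) ≈⟨ *ₗ-congˡ e ⟩
    z *ₗ y        ∎
    where open import Relation.Binary.Reasoning.Setoid ≈ᴹ-setoid

  k*x≈0⇒x≈0 : ∀ {k x} → ¬ (k ≈ 0#) → k *ₗ x ≈ᴹ 0ᴹ → x ≈ᴹ 0ᴹ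
  k*x≈0⇒x≈0 {k} k≉0 e with inverse k k≉0
  ... | z , kz≈1 = ≈ᴹ-trans (*ₗ-cancelˡ (trans (*-comm z k) kz≈1) e) (*ₗ-zeroʳ z)

  module _ {α β : Carrierᴹ} where

    lin-cong : ∀ {a b c d} → a ≈ c → b ≈ d → lin α β a b ≈ᴹ lin α β c d
    lin-cong p q = +ᴹ-cong (*ₗ-congʳ p) (*ₗ-congʳ q)

    lin-+ : ∀ a b c d → lin α β a b +ᴹ lin α β c d ≈ᴹ lin α β (a + c) (b + d)
    lin-+ a b c d = ≈ᴹ-trans (interchange _ _ _ _)
      (+ᴹ-cong (≈ᴹ-sym (*ₗ-distribʳ α a c)) (≈ᴹ-sym (*ₗ-distribʳ β b d)))

    lin-* : ∀ k a b → k *ₗ lin α β a b ≈ᴹ lin α β (k * a) (k * b)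
    lin-* k a b = ≈ᴹ-trans (*ₗ-distribˡ k _ _)
      (+ᴹ-cong (≈ᴹ-sym (*ₗ-assoc k a α)) (≈ᴹ-sym (*ₗ-assoc k b β)))

    lin-zero : lin α β 0# 0# ≈ᴹ 0ᴹ
    lin-zero = ≈ᴹ-trans (+ᴹ-cong (*ₗ-zeroˡ α) (*ₗ-zeroˡ β)) (+ᴹ-identityˡ 0ᴹ)

    lin-first : α ≈ᴹ lin α β 1# 0#
    lin-first = ≈ᴹ-sym (≈ᴹ-trans (+ᴹ-cong (*ₗ-identityˡ α) (*ₗ-zeroˡ β)) (+ᴹ-identityʳ α))

    lin-second : β ≈ᴹ lin α β 0# 1#
    lin-second = ≈ᴹ-sym (≈ᴹ-trans (+ᴹ-cong (*ₗ-zeroˡ α) (*ₗ-identityˡ β)) (+ᴹ-identityˡ β))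

    lin-*-lin : ∀ {x a b} k → x ≈ᴹ lin α β a b → k *ₗ x ≈ᴹ lin α β (k * a) (k * b)
    lin-*-lin k e = ≈ᴹ-trans (*ₗ-congˡ e) (lin-* k _ _)

    lin-lin : ∀ {x y a b c d} s t → x ≈ᴹ lin α β a b → y ≈ᴹ lin α β c d →
              lin x y s t ≈ᴹ lin α β (s * a + t * c) (s * b + t * d)
    lin-lin s t p q = ≈ᴹ-trans (+ᴹ-cong (lin-*-lin s p) (lin-*-lin t q)) (lin-+ _ _ _ _)

  combination-∈ : ∀ {k} {K : Pred Carrierᴹ k} → 0ᴹ ∈ K → (∀ {x y} → x ∈ K → y ∈ K → x +ᴹ y ∈ K) →
                  ∀ {n} (a : Vector Carrier n) (v : Vector Carrierᴹ n) →
                  (∀ i → a i *ₗ v i ∈ K) → combination a v ∈ K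
  combination-∈ z p {ℕ.zero}  a v h = z
  combination-∈ {K = K} z p {ℕ.suc n} a v h =
    p (h Fin.zero) (combination-∈ {K = K} z p (a ∘ Fin.suc) (v ∘ Fin.suc) (h ∘ Fin.suc))

  plane-isSubspace : ∀ α β → IsSubspace (Plane α β)
  plane-isSubspace α β = record
    { respects = λ x≈y (a , b , e) → a , b , ≈ᴹ-trans (≈ᴹ-sym x≈y) e
    ; zero-∈   = 0# , 0# , ≈ᴹ-sym lin-zero
    ; +-∈      = λ (a , b , e) (c , d , f) →
        a + c , b + d , ≈ᴹ-trans (+ᴹ-cong e f) (lin-+ a b c d)
    ; *-∈      = λ k (a , b , e) → k * a , k * b , lin-*-lin k e
    }

  span-least : ∀ {S L : Pred Carrierᴹ ℓ} → IsSubspace L → S ⊆ L → Span S ⊆ L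
  span-least {L = L} isSub S⊆L (n , k , v , v∈S , e) =
    respects (≈ᴹ-sym e) (combination-∈ {K = L} zero-∈ +-∈ k v (λ i → *-∈ (k i) (S⊆L (v∈S i))))
    where open IsSubspace isSub

  span-mono : ∀ {S T : Pred Carrierᴹ ℓ} → S ⊆ T → Span S ⊆ Span T
  span-mono S⊆T (n , k , v , v∈S , e) = n , k , v , (λ i → S⊆T (v∈S i)) , e

  span₊-mono : ∀ {S T : Pred Carrierᴹ ℓ} → S ⊆ T → Span₊ S ⊆ Span₊ T
  span₊-mono S⊆T (n , k , v , k≥0 , v∈S , e) = n , k , v , k≥0 , (λ i → S⊆T (v∈S i)) , e

  span₊⇒span : ∀ {S : Pred Carrierᴹ ℓ} → Span₊ S ⊆ Span S
  span₊⇒span (n , k , v , k≥0 , v∈S , e) = n , k , v , v∈S , e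

  lin-combination : ∀ {x} a b α β → x ≈ᴹ lin α β a b →
                    x ≈ᴹ combination (a ∷ b ∷ []) (α ∷ β ∷ [])
  lin-combination a b α β e = ≈ᴹ-trans e (+ᴹ-congˡ (≈ᴹ-sym (+ᴹ-identityʳ _)))

  plane⇒span : ∀ {S : Pred Carrierᴹ ℓ} {α β} → α ∈ S → β ∈ S → Plane α β ⊆ Span S
  plane⇒span {α = α} {β} α∈S β∈S (a , b , e) =
    2 , a ∷ b ∷ [] , α ∷ β ∷ [] , (λ { Fin.zero → α∈S ; (Fin.suc Fin.zero) → β∈S }) ,
    lin-combination a b α β e

  cone⇒span₊ : ∀ {S : Pred Carrierᴹ ℓ} {α β} → α ∈ S → β ∈ S → Cone α β ⊆ Span₊ S
  cone⇒span₊ {α = α} {β} α∈S β∈S (a , b , a≥0 , b≥0 , e) =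
    2 , a ∷ b ∷ [] , α ∷ β ∷ [] , (λ { Fin.zero → a≥0 ; (Fin.suc Fin.zero) → b≥0 }) ,
    (λ { Fin.zero → α∈S ; (Fin.suc Fin.zero) → β∈S }) , lin-combination a b α β e

  span₊⇒cone : ∀ {α β} → Span₊ ⟅ α , β ⟆ ⊆ Cone α β
  span₊⇒cone {α} {β} (n , k , v , k≥0 , v∈S , e) = resp e
    (combination-∈ {K = Cone α β}
      (0# , 0# , ≤-refl , ≤-refl , ≈ᴹ-sym lin-zero)
      (λ (a , b , p , q , e) (c , d , r , s , f) →
        a + c , b + d , +-nonNeg p r , +-nonNeg q s , ≈ᴹ-trans (+ᴹ-cong e f) (lin-+ a b c d))
      k v (λ i → scale (k≥0 i) (generator (v∈S i))))
    where
    resp : ∀ {x y} → x ≈ᴹ y → y ∈ Cone α β → x ∈ Cone α β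
    resp x≈y (a , b , p , q , e) = a , b , p , q , ≈ᴹ-trans x≈y e
    scale : ∀ {c x} → NonNeg c → x ∈ Cone α β → c *ₗ x ∈ Cone α β
    scale {c} c≥0 (a , b , p , q , e) =
      c * a , c * b , *-nonNeg c≥0 p , *-nonNeg c≥0 q , lin-*-lin c e
    generator : ⟅ α , β ⟆ ⊆ Cone α β
    generator (first x≈α)  = resp x≈α (1# , 0# , 0≤1 , ≤-refl , lin-first)
    generator (second x≈β) = resp x≈β (0# , 1# , ≤-refl , 0≤1 , lin-second)

  cone⇒pair : ∀ {α β} → Cone α β ⊆ Span₊ ⟅ α , β ⟆
  cone⇒pair {α} {β} = cone⇒span₊ {S = ⟅ α , β ⟆} (first ≈ᴹ-refl) (second ≈ᴹ-refl)

  pair-swap : ∀ {α β} → Span₊ ⟅ α , β ⟆ ⊆ Span₊ ⟅ β , α ⟆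
  pair-swap {α} {β} = span₊-mono {S = ⟅ α , β ⟆} {⟅ β , α ⟆}
    λ { (first p) → second p ; (second p) → first p }

  pair-congʳ : ∀ {α β γ} → β ≈ᴹ γ → Span₊ ⟅ α , β ⟆ ⊆ Span₊ ⟅ α , γ ⟆
  pair-congʳ {α} {β} {γ} β≈γ = span₊-mono {S = ⟅ α , β ⟆} {⟅ α , γ ⟆}
    λ { (first p) → first p ; (second p) → second (≈ᴹ-trans p β≈γ) }

  ∈-pair : ∀ {α β x} → x ≈ᴹ α → x ∈ Span₊ ⟅ α , β ⟆
  ∈-pair x≈α = cone⇒pair (1# , 0# , 0≤1 , ≤-refl , ≈ᴹ-trans x≈α lin-first)

  ∈-ray : ∀ {α x k} → NonNeg k → x ≈ᴹ k *ₗ α → x ∈ Span₊ ⟅ α , α ⟆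
  ∈-ray {α} {x} {k} k≥0 e = cone⇒pair (k , 0# , k≥0 , ≤-refl ,
    ≈ᴹ-trans e (≈ᴹ-sym (≈ᴹ-trans (+ᴹ-congˡ (*ₗ-zeroˡ α)) (+ᴹ-identityʳ _))))

  ∈-ray⁻¹ : ∀ {α x k} → NonNeg k → ¬ (x ≈ᴹ 0ᴹ) → x ≈ᴹ k *ₗ α → α ∈ Span₊ ⟅ x , x ⟆
  ∈-ray⁻¹ {α} {x} {k} k≥0 x≉0 e with inverse-nonNeg k≥0 (λ k≈0 → x≉0 (≈ᴹ-trans e (x≈0⇒x*y≈0 k≈0)))
  ... | z , z≥0 , zk≈1 = ∈-ray z≥0 (*ₗ-cancelˡ zk≈1 (≈ᴹ-sym e))

  pair⇒ray : ∀ {α x} → x ∈ Span₊ ⟅ α , α ⟆ → ∃[ k ] NonNeg k × x ≈ᴹ k *ₗ α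
  pair⇒ray {α} x∈ with span₊⇒cone x∈
  ... | a , b , p , q , e = a + b , +-nonNeg p q , ≈ᴹ-trans e (≈ᴹ-sym (*ₗ-distribʳ α a b))

  ray-swap : ∀ {α x} → ¬ (x ≈ᴹ 0ᴹ) → x ∈ Span₊ ⟅ α , α ⟆ → α ∈ Span₊ ⟅ x , x ⟆
  ray-swap x≉0 x∈ with pair⇒ray x∈
  ... | k , k≥0 , e = ∈-ray⁻¹ k≥0 x≉0 e

  cone-divide : ∀ {α β x t u v} → NonNeg t → ¬ (t ≈ 0#) → NonNeg u → NonNeg v →
                t *ₗ x ≈ᴹ lin α β u v → x ∈ Cone α β
  cone-divide {u = u} {v} t≥0 t≉0 u≥0 v≥0 e with inverse-nonNeg t≥0 t≉0
  ... | z , z≥0 , zt≈1 = z * u , z * v , *-nonNeg z≥0 u≥0 , *-nonNeg z≥0 v≥0 ,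
    ≈ᴹ-trans (*ₗ-cancelˡ zt≈1 e) (lin-* z u v)

  span-solveʳ : ∀ {α β γ x y} → γ ≈ᴹ lin α β x y → ¬ (y ≈ 0#) → β ∈ Span ⟅ α , γ ⟆
  span-solveʳ {α} {β} {γ} {x} {y} e y≉0 with inverse y y≉0
  ... | z , yz≈1 = plane⇒span {S = ⟅ α , γ ⟆} (first ≈ᴹ-refl) (second ≈ᴹ-refl)
    (- (z * x) , z , ≈ᴹ-sym (≈ᴹ-trans (lin-lin (- (z * x)) z lin-first e)
      (≈ᴹ-trans (lin-cong c₁ c₂) (≈ᴹ-sym lin-second))))
    where
    c₁ : - (z * x) * 1# + z * x ≈ 0#
    c₁ = trans (+-congʳ (*-identityʳ _)) (-‿inverseˡ (z * x))
    c₂ : - (z * x) * 0# + z * y ≈ 1#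
    c₂ = trans (+-cong (zeroʳ _) (trans (*-comm z y) yz≈1)) (+-identityˡ 1#)

  -- The hypothesis p s = q r + d with d > 0 says that γ lies strictly between α and δ.
  cone-between : ∀ {α β γ δ ε p q r s d a b} →
    NonNeg q → NonNeg r → NonNeg s → NonNeg d → NonNeg a → NonNeg b →
    ¬ (d ≈ 0#) → ¬ (b ≈ 0#) → p * s ≈ q * r + d →
    γ ≈ᴹ lin α β p q → δ ≈ᴹ lin α β r s → ε ≈ᴹ lin γ δ a b →
    γ ∈ Cone α ε × ε ∈ Cone α δ
  cone-between {α} {β} {γ} {δ} {ε} {p} {q} {r} {s} {d} {a} {b}
    q≥0 r≥0 s≥0 d≥0 a≥0 b≥0 d≉0 b≉0 det γ≈ δ≈ ε≈γδ =
    cone-divide (+-nonNeg (*-nonNeg a≥0 q≥0) (*-nonNeg b≥0 s≥0)) t≉0 (*-nonNeg b≥0 d≥0) q≥0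
      (≈ᴹ-trans (lin-*-lin t γ≈)
        (≈ᴹ-trans (lin-cong γ₁ γ₂) (≈ᴹ-sym (lin-lin (b * d) q lin-first ε≈)))) ,
    cone-divide s≥0 s≉0 (*-nonNeg a≥0 d≥0) (+-nonNeg (*-nonNeg a≥0 q≥0) (*-nonNeg b≥0 s≥0))
      (≈ᴹ-trans (lin-*-lin s ε≈)
        (≈ᴹ-trans (lin-cong ε₁ ε₂) (≈ᴹ-sym (lin-lin (a * d) t lin-first δ≈))))
    where
    open import Relation.Binary.Reasoning.Setoid setoid
    t = a * q + b * s
    ε≈ : ε ≈ᴹ lin α β (a * p + b * r) (a * q + b * s)
    ε≈ = ≈ᴹ-trans ε≈γδ (lin-lin a b γ≈ δ≈)
    s≉0 : ¬ (s ≈ 0#)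
    s≉0 s≈0 = d≉0 (nonNeg-sum-zeroʳ (*-nonNeg q≥0 r≥0) d≥0
      (trans (sym det) (trans (*-congˡ s≈0) (zeroʳ p))))
    t≉0 : ¬ (t ≈ 0#)
    t≉0 t≈0 = s≉0 (x*y≈0⇒y≈0 b≉0 (nonNeg-sum-zeroʳ (*-nonNeg a≥0 q≥0) (*-nonNeg b≥0 s≥0) t≈0))
    γ₁ : t * p ≈ b * d * 1# + q * (a * p + b * r)
    γ₁ = begin
      t * p                             ≈⟨ solve 5 (λ a b p q s →
        (a :* q :+ b :* s) :* p := a :* q :* p :+ b :* (p :* s)) refl a b p q s ⟩
      a * q * p + b * (p * s)           ≈⟨ +-congˡ (*-congˡ det) ⟩
      a * q * p + b * (q * r + d)       ≈⟨ solve 6 (λ a b p q r d →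
        a :* q :* p :+ b :* (q :* r :+ d) :=
        b :* d :* con 1 :+ q :* (a :* p :+ b :* r)) refl a b p q r d ⟩
      b * d * 1# + q * (a * p + b * r)  ∎
    γ₂ : t * q ≈ b * d * 0# + q * t
    γ₂ = sym (trans (+-cong (zeroʳ _) (*-comm q t)) (+-identityˡ _))
    ε₁ : s * (a * p + b * r) ≈ a * d * 1# + t * r
    ε₁ = begin
      s * (a * p + b * r)          ≈⟨ solve 5 (λ a b p r s →
        s :* (a :* p :+ b :* r) := a :* (p :* s) :+ b :* r :* s) refl a b p r s ⟩
      a * (p * s) + b * r * s      ≈⟨ +-congʳ (*-congˡ det) ⟩
      a * (q * r + d) + b * r * s  ≈⟨ solve 6 (λ a b q r s d →
        a :* (q :* r :+ d) :+ b :* r :* s :=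
        a :* d :* con 1 :+ (a :* q :+ b :* s) :* r) refl a b q r s d ⟩
      a * d * 1# + t * r           ∎
    ε₂ : s * t ≈ a * d * 0# + t * s
    ε₂ = sym (trans (+-cong (zeroʳ _) (*-comm t s)) (+-identityˡ _))

module Biclosed {ℓ} (em : ExcludedMiddle (suc ℓ)) (ℝ : RealField ℓ) (V : VectorSpace ℝ) where
  open RealField ℝ
  open Module V
  open Geometry ℝ V
  open OrderedField ℝ
  open Cones ℝ V
  open import Algebra.Module.Properties V using (x≈0⇒x*y≈0; inverseˡ-uniqueᴹ)

  open import Algebra.Properties.Ring ring using (-‿distribʳ-*; -‿involutive)

  decide : ExcludedMiddle ℓ
  decide {P} = map′ lower lift (em {Lift (suc ℓ) P})

  stable : {P : Set ℓ} → ¬ ¬ P → P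
  stable = decidable-stable decide

  closedIn-resp-≐ : ∀ {Y B C : Pred Carrierᴹ ℓ} → B ≐ C → ClosedIn Y B → ClosedIn Y C
  closedIn-resp-≐ (B⊆C , C⊆B) closed α∈C β∈C γ∈ = B⊆C (closed (C⊆B α∈C) (C⊆B β∈C) γ∈)

  complement-biclosed : ∀ {Y B : Pred Carrierᴹ ℓ} → BiclosedIn Y B → BiclosedIn Y (Y ∖ B)
  complement-biclosed {Y} {B} bi = record
    { contained = proj₁
    ; closed    = coclosed
    ; coclosed  = closedIn-resp-≐ {Y} {B} {Y ∖ (Y ∖ B)}
        ((λ x∈B → contained x∈B , λ x∈ → proj₂ x∈ x∈B) ,
         (λ (x∈Y , x∉) → stable λ x∉B → x∉ (x∈Y , x∉B))) closed
    }
    where open BiclosedIn bi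

  *ₗ-neg-neg : ∀ k x → k *ₗ x ≈ᴹ (- k) *ₗ (- 1# *ₗ x)
  *ₗ-neg-neg k x = ≈ᴹ-trans (*ₗ-congʳ (sym (begin
    - k * - 1#     ≈⟨ -‿distribʳ-* (- k) 1# ⟨
    - (- k * 1#)   ≈⟨ -‿cong (*-identityʳ (- k)) ⟩
    - - k          ≈⟨ -‿involutive k ⟩
    k              ∎))) (*ₗ-assoc (- k) (- 1#) x)
    where open import Relation.Binary.Reasoning.Setoid setoid

  ray-exchange : ∀ {γ δ ε m} → ¬ (ε ≈ᴹ 0ᴹ) → γ ≈ᴹ m *ₗ δ → ε ∈ Cone γ δ →
                 γ ∈ Span₊ ⟅ ε , ε ⟆ ⊎ ε ∈ Span₊ ⟅ δ , δ ⟆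
  ray-exchange {γ} {δ} {ε} {m} ε≉0 γ≈mδ (a , b , a≥0 , b≥0 , ε≈γδ) = go (total 0# c) (total 0# m)
    where
    c = a * m + b
    ε≈cδ : ε ≈ᴹ c *ₗ δ
    ε≈cδ = ≈ᴹ-trans ε≈γδ (≈ᴹ-sym (≈ᴹ-trans (*ₗ-distribʳ δ (a * m) b)
      (+ᴹ-congʳ (≈ᴹ-trans (*ₗ-assoc a m δ) (*ₗ-congˡ (≈ᴹ-sym γ≈mδ))))))
    go : NonNeg c ⊎ c ≤ 0# → NonNeg m ⊎ m ≤ 0# → γ ∈ Span₊ ⟅ ε , ε ⟆ ⊎ ε ∈ Span₊ ⟅ δ , δ ⟆
    go (inj₁ c≥0) _          = inj₂ (∈-ray c≥0 ε≈cδ)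
    go (inj₂ c≤0) (inj₁ m≥0) = inj₂ (∈-ray (+-nonNeg (*-nonNeg a≥0 m≥0) b≥0) ε≈cδ)
    go (inj₂ c≤0) (inj₂ m≤0)
      with pair⇒ray (∈-ray⁻¹ (nonPos⇒-nonNeg c≤0) ε≉0 (≈ᴹ-trans ε≈cδ (*ₗ-neg-neg c δ)))
    ... | k , k≥0 , -δ≈kε = inj₁ (∈-ray (*-nonNeg (nonPos⇒-nonNeg m≤0) k≥0)
      (≈ᴹ-trans γ≈mδ (≈ᴹ-trans (*ₗ-neg-neg m δ)
        (≈ᴹ-trans (*ₗ-congˡ -δ≈kε) (≈ᴹ-sym (*ₗ-assoc (- m) k ε))))))

  module _ {γ δ} (δ≉0 : ¬ (δ ≈ᴹ 0ᴹ)) (γ∦δ : ¬ (∃[ m ] γ ≈ᴹ m *ₗ δ)) where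

    nonparallel⇒zero : ∀ {k l} → k *ₗ γ ≈ᴹ l *ₗ δ → k ≈ 0#
    nonparallel⇒zero {k} {l} e = stable λ k≉0 →
      let z , kz≈1 = inverse k k≉0 in
      γ∦δ (z * l , ≈ᴹ-trans (*ₗ-cancelˡ (trans (*-comm z k) kz≈1) e) (≈ᴹ-sym (*ₗ-assoc z l δ)))

    nonparallel⇒independent : LinearlyIndependent (γ ∷ δ ∷ [])
    nonparallel⇒independent k sum≈0 = λ { Fin.zero → k₀≈0 ; (Fin.suc Fin.zero) → k₁≈0 }
      where
      k₀ = k Fin.zero
      k₁ = k (Fin.suc Fin.zero)
      lin≈0 : lin γ δ k₀ k₁ ≈ᴹ 0ᴹ
      lin≈0 = ≈ᴹ-trans (lin-combination k₀ k₁ γ δ ≈ᴹ-refl) sum≈0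
      neg : - k₁ *ₗ δ ≈ᴹ -ᴹ (k₁ *ₗ δ)
      neg = inverseˡ-uniqueᴹ _ _ (≈ᴹ-trans (≈ᴹ-sym (*ₗ-distribʳ δ (- k₁) k₁))
        (x≈0⇒x*y≈0 (-‿inverseˡ k₁)))
      k₀≈0 : k₀ ≈ 0#
      k₀≈0 = nonparallel⇒zero (≈ᴹ-trans (inverseˡ-uniqueᴹ _ _ lin≈0) (≈ᴹ-sym neg))
      k₁≈0 : k₁ ≈ 0#
      k₁≈0 = stable λ k₁≉0 → δ≉0 (k*x≈0⇒x≈0 k₁≉0 (≈ᴹ-trans (≈ᴹ-sym (+ᴹ-identityˡ _))
        (≈ᴹ-trans (+ᴹ-congʳ (≈ᴹ-sym (x≈0⇒x*y≈0 k₀≈0))) lin≈0)))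

    nonparallel⇒det≉0 : ∀ {α β p q r s} → γ ≈ᴹ lin α β p q → δ ≈ᴹ lin α β r s → ¬ (p * s ≈ q * r)
    nonparallel⇒det≉0 {α} {β} {p} {q} {r} {s} γ≈ δ≈ det =
      δ≉0 (≈ᴹ-trans δ≈ (≈ᴹ-trans (lin-cong r≈0 s≈0) lin-zero))
      where
      r≈0 : r ≈ 0#
      r≈0 = nonparallel⇒zero (≈ᴹ-trans (lin-*-lin r γ≈) (≈ᴹ-trans
        (lin-cong (*-comm r p) (trans (*-comm r q) (sym det))) (≈ᴹ-sym (lin-*-lin p δ≈))))
      s≈0 : s ≈ 0#
      s≈0 = nonparallel⇒zero (≈ᴹ-trans (lin-*-lin s γ≈) (≈ᴹ-trans
        (lin-cong (trans (*-comm s p) det) (*-comm s q)) (≈ᴹ-sym (lin-*-lin q δ≈))))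

    plane-exchange : ∀ {α β ε} → ¬ (ε ≈ᴹ 0ᴹ) → γ ∈ Cone α β → δ ∈ Cone α β → ε ∈ Cone γ δ →
      γ ∈ Span₊ ⟅ ε , ε ⟆ ⊎ (γ ∈ Cone α ε × ε ∈ Cone α δ) ⊎ (γ ∈ Cone β ε × ε ∈ Cone β δ)
    plane-exchange {α} {β} {ε} ε≉0 (p , q , p≥0 , q≥0 , γ≈) (r , s , r≥0 , s≥0 , δ≈)
      (a , b , a≥0 , b≥0 , ε≈) with decide {b ≈ 0#}
    ... | yes b≈0 = inj₁ (∈-ray⁻¹ a≥0 ε≉0 (≈ᴹ-trans ε≈
          (≈ᴹ-trans (+ᴹ-congˡ (x≈0⇒x*y≈0 b≈0)) (+ᴹ-identityʳ _))))
    ... | no b≉0 with total (q * r) (p * s)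
    ...   | inj₁ qr≤ps = let d , d≥0 , det = difference qr≤ps in inj₂ (inj₁
              (cone-between q≥0 r≥0 s≥0 d≥0 a≥0 b≥0
                (λ d≈0 → nonparallel⇒det≉0 γ≈ δ≈ (trans det (trans (+-congˡ d≈0) (+-identityʳ _))))
                b≉0 det γ≈ δ≈ ε≈))
    ...   | inj₂ ps≤qr = let d , d≥0 , det = difference ps≤qr in inj₂ (inj₂
              (cone-between p≥0 s≥0 r≥0 d≥0 a≥0 b≥0
                (λ d≈0 → nonparallel⇒det≉0 γ≈ δ≈
                  (sym (trans det (trans (+-congˡ d≈0) (+-identityʳ _)))))
                b≉0 det (≈ᴹ-trans γ≈ (+ᴹ-comm _ _)) (≈ᴹ-trans δ≈ (+ᴹ-comm _ _)) ε≈))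

  fundamental-swap : ∀ {Y α β} → FundamentalVectors Y α β → FundamentalVectors Y β α
  fundamental-swap (α∈Y , β∈Y , Y⊆ , α∉ , β∉) =
    β∈Y , α∈Y , (λ x∈Y → pair-swap (Y⊆ x∈Y)) , β∉ , α∉

  position-injective : ∀ {l} {i j : Index l} → position i ≡ position j → i ≡ j
  position-injective {finite n} = toℕ-injective
  position-injective {infinite} = id

  module _ (X : Pred Carrierᴹ ℓ) (X-resp : X Respects _≈ᴹ_) where

    plane-twoDimensional : ∀ {γ δ} → γ ∈ X → δ ∈ X → LinearlyIndependent (γ ∷ δ ∷ []) →
                           TwoDimensionalLinearSubset X (X ∩ Plane γ δ)
    plane-twoDimensional {γ} {δ} γ∈X δ∈X independent =
      (Plane γ δ , plane-isSubspace γ δ , id , id) , γ ∷ δ ∷ [] , independent ,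
      span-mono {S = Basis} {T = X ∩ Plane γ δ} basis⊆ ,
      λ x∈ → plane⇒span {S = Basis} (Fin.zero , ≈ᴹ-refl) (Fin.suc Fin.zero , ≈ᴹ-refl)
        (span-least {S = X ∩ Plane γ δ} (plane-isSubspace γ δ) proj₂ x∈)
      where
      Basis : Pred Carrierᴹ ℓ
      Basis x = ∃[ i ] x ≈ᴹ (γ ∷ δ ∷ []) i
      basis⊆ : Basis ⊆ X ∩ Plane γ δ
      basis⊆ (Fin.zero , x≈γ) =
        X-resp (≈ᴹ-sym x≈γ) γ∈X , 1# , 0# , ≈ᴹ-trans x≈γ lin-first
      basis⊆ (Fin.suc Fin.zero , x≈δ) =
        X-resp (≈ᴹ-sym x≈δ) δ∈X , 0# , 1# , ≈ᴹ-trans x≈δ lin-second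

    coclosed-resp : ∀ {A : Pred Carrierᴹ ℓ} → A ⊆ X → ClosedIn X (X ∖ A) → A Respects _≈ᴹ_
    coclosed-resp {A} A⊆X coclosed x≈y x∈A = stable λ y∉A →
      let y∈ = X-resp x≈y (A⊆X x∈A) , y∉A
      in proj₂ (coclosed y∈ y∈ (∈-pair x≈y , A⊆X x∈A)) x∈A

    module _ (0∉X : ∀ {x} → x ∈ X → ¬ (x ≈ᴹ 0ᴹ))
             (fundamental : HasAllFundamentalVectors X)
             (order : Ordering X) (suitable : Suitable X order) where
      open Ordering order
      open Suitable suitable

      New : ℕ → Pred Carrierᴹ ℓ
      New n x = ∃[ i ] x ≈ᴹ vector i × position i ≡ n

      segment⊆X : ∀ {n} → segment n ⊆ X
      segment⊆X (i , e , _) = X-resp (≈ᴹ-sym e) (member i)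

      new⊆X : ∀ {n} → New n ⊆ X
      new⊆X (i , e , _) = X-resp (≈ᴹ-sym e) (member i)

      new-unique : ∀ {n x y} → x ∈ New n → y ∈ New n → x ≈ᴹ y
      new-unique (i , x≈ , i≡n) (j , y≈ , j≡n)
        with ≡.refl ← position-injective {length} {i} {j} (≡.trans i≡n (≡.sym j≡n)) =
          ≈ᴹ-trans x≈ (≈ᴹ-sym y≈)

      segment-suc : ∀ {n} → segment (ℕ.suc n) ≐ segment n ∪ New n
      segment-suc {n} = split , join
        where
        split : segment (ℕ.suc n) ⊆ segment n ∪ New n
        split (i , e , i<1+n) with ℕ.m<1+n⇒m<n∨m≡n i<1+n
        ... | inj₁ i<n = inj₁ (i , e , i<n)
        ... | inj₂ i≡n = inj₂ (i , e , i≡n)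
        join : segment n ∪ New n ⊆ segment (ℕ.suc n)
        join (inj₁ (i , e , i<n)) = i , e , ℕ.m<n⇒m<1+n i<n
        join (inj₂ (i , e , ≡.refl)) = i , e , ℕ.≤-refl

      precedes-new : ∀ {n x y} → y ∈ New n → x precedes y → x ∈ segment n
      precedes-new (k , y≈k , ≡.refl) (i , j , x≈ , y≈ , i<j)
        with ≡.refl ← injective (≈ᴹ-trans (≈ᴹ-sym y≈) y≈k) = i , x≈ , i<j

      new-follows : ∀ {n x y} → x ∈ New n → y ∈ segment n → ¬ (x precedes y)
      new-follows (k , x≈k , ≡.refl) (l , y≈l , l<n) (i , j , x≈ , y≈ , i<j)
        with ≡.refl ← injective (≈ᴹ-trans (≈ᴹ-sym x≈) x≈k)
           | ≡.refl ← injective (≈ᴹ-trans (≈ᴹ-sym y≈) y≈l) = ℕ.<-asym i<j l<n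

      new≉segment : ∀ {n x y} → x ∈ New n → y ∈ segment n → ¬ (x ≈ᴹ y)
      new≉segment (k , x≈k , ≡.refl) (l , y≈l , l<n) x≈y
        with ≡.refl ← injective (≈ᴹ-trans (≈ᴹ-sym x≈k) (≈ᴹ-trans x≈y y≈l)) = ℕ.<-irrefl ≡.refl l<n

      Exchange : ℕ → Carrierᴹ → Carrierᴹ → Carrierᴹ → Set ℓ
      Exchange n γ δ ε = γ ∈ Span₊ ⟅ ε , ε ⟆ ⊎ ε ∈ Span₊ ⟅ δ , δ ⟆ ⊎
        (∃[ α ] α ∈ segment n × γ ∈ Span₊ ⟅ α , ε ⟆ × ε ∈ Span₊ ⟅ α , δ ⟆)

      exchange : ∀ {n γ δ ε} → γ ∈ New n → δ ∈ segment n → ε ∈ segment n →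
                 ε ∈ Span₊ ⟅ γ , δ ⟆ → Exchange n γ δ ε
      exchange {n} {γ} {δ} {ε} γ∈N δ∈P ε∈P ε∈γδ with decide {∃[ m ] γ ≈ᴹ m *ₗ δ}
      ... | yes (m , e) = [ inj₁ , inj₂ ∘ inj₁ ]′
              (ray-exchange (0∉X (segment⊆X ε∈P)) e (span₊⇒cone ε∈γδ))
      ... | no γ∦δ = inPlane (fundamental Y twoDim)
        where
        δ≉0 = 0∉X (segment⊆X δ∈P)
        Y = X ∩ Plane γ δ
        twoDim = plane-twoDimensional (new⊆X γ∈N) (segment⊆X δ∈P) (nonparallel⇒independent δ≉0 γ∦δ)
        γ∈Y : γ ∈ Y
        γ∈Y = new⊆X γ∈N , 1# , 0# , lin-first
        δ∈Y : δ ∈ Y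
        δ∈Y = segment⊆X δ∈P , 0# , 1# , lin-second
        ε∈Y : ε ∈ Y
        ε∈Y = segment⊆X ε∈P , let a , b , _ , _ , e = span₊⇒cone ε∈γδ in a , b , e

        boundary : ∀ {α β} → FundamentalVectors Y α β → γ ≈ᴹ α → Exchange n γ δ ε
        boundary {α} {β} fv@(_ , _ , _ , _ , β∉) γ≈α with decide {ε ≈ᴹ β} | decide {δ ≈ᴹ β}
        ... | yes ε≈β | yes δ≈β = inj₂ (inj₁ (∈-pair (≈ᴹ-trans ε≈β (≈ᴹ-sym δ≈β))))
        ... | yes ε≈β | no δ≉β = ⊥-elim (β∉ (cone⇒span₊ {S = Y ∖ (_≈ᴹ β)}
                (γ∈Y , λ γ≈β → new≉segment γ∈N ε∈P (≈ᴹ-trans γ≈β (≈ᴹ-sym ε≈β))) (δ∈Y , δ≉β)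
                (let a , b , p , q , e = span₊⇒cone ε∈γδ
                 in a , b , p , q , ≈ᴹ-trans (≈ᴹ-sym ε≈β) e)))
        ... | no ε≉β | _ = ⊥-elim (new-follows (let i , e , p = γ∈N in
                i , ≈ᴹ-trans (≈ᴹ-sym γ≈α) e , p) ε∈P (proj₁ (fundamental-first Y twoDim fv ε∈Y
                  (λ ε≈α → new≉segment γ∈N ε∈P (≈ᴹ-trans γ≈α (≈ᴹ-sym ε≈α))) ε≉β)))

        inPlane : ∃[ α ] ∃[ β ] FundamentalVectors Y α β → Exchange n γ δ ε
        inPlane (α , β , fv@(_ , _ , Y⊆ , _)) with decide {γ ≈ᴹ α} | decide {γ ≈ᴹ β}
        ... | yes γ≈α | _       = boundary fv γ≈α
        ... | no  _   | yes γ≈β = boundary (fundamental-swap fv) γ≈β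
        ... | no  γ≉α | no γ≉β
          with fundamental-first Y twoDim fv γ∈Y γ≉α γ≉β
             | plane-exchange δ≉0 γ∦δ (0∉X (segment⊆X ε∈P))
                 (span₊⇒cone (Y⊆ γ∈Y)) (span₊⇒cone (Y⊆ δ∈Y)) (span₊⇒cone ε∈γδ)
        ... | _        | inj₁ x              = inj₁ x
        ... | α<γ , _  | inj₂ (inj₁ (x , y)) =
          inj₂ (inj₂ (α , precedes-new γ∈N α<γ , cone⇒pair x , cone⇒pair y))
        ... | _  , β<γ | inj₂ (inj₂ (x , y)) =
          inj₂ (inj₂ (β , precedes-new γ∈N β<γ , cone⇒pair x , cone⇒pair y))

      new-not-both : ∀ {n C γ μ ν α β} → BiclosedIn (segment n) C → γ ∈ New n →
        μ ∈ C → ν ∈ C → γ ∈ Span₊ ⟅ μ , ν ⟆ →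
        α ∈ segment n ∖ C → β ∈ segment n ∖ C → γ ∉ Span₊ ⟅ α , β ⟆
      new-not-both {n} {C} {γ} {μ} {ν} {α} {β} bi γ∈N μ∈C ν∈C γ∈μν α∈D β∈D γ∈αβ
        with locally-clean n (BiclosedIn.contained bi μ∈C) (BiclosedIn.contained bi ν∈C) (proj₁ α∈D)
      ... | F , F-full , μ∈F , ν∈F , α∈F , clean = conclude (span₊⇒cone γ∈αβ)
        where
        open BiclosedIn bi
        open Full F-full using (full)
        γ∈F : γ ∈ F
        γ∈F = proj₁ (proj₂ (full μ∈F ν∈F) (new⊆X γ∈N , span₊⇒span {S = ⟅ μ , ν ⟆} γ∈μν))

        G = F ∩ segment n
        C∩F-biclosed : BiclosedIn G (C ∩ F)
        C∩F-biclosed = record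
          { contained = λ (x∈C , x∈F) → x∈F , contained x∈C
          ; closed    = λ (α∈C , _) (β∈C , _) (γ∈αβ , γ∈F , γ∈P) →
              closed α∈C β∈C (γ∈αβ , γ∈P) , γ∈F
          ; coclosed  = λ ((α∈F , α∈P) , α∉) ((β∈F , β∈P) , β∉) (γ∈αβ , γ∈F , γ∈P) →
              (γ∈F , γ∈P) , λ (γ∈C , _) → proj₂ (coclosed
                (α∈P , λ α∈C → α∉ (α∈C , α∈F)) (β∈P , λ β∈C → β∉ (β∈C , β∈F)) (γ∈αβ , γ∈P)) γ∈C
          }

        -- β need not be given in F: fullness puts it there once it lies in the plane of α and γ.
        separate : ∀ {β} → β ∈ segment n ∖ C → γ ∈ Span₊ ⟅ α , β ⟆ → β ∉ Span ⟅ α , γ ⟆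
        separate {β} (β∈P , β∉C) γ∈αβ β∈αγ = 0∉X (new⊆X γ∈N)
          (proj₁ (clean (C ∩ F) C∩F-biclosed)
            ( cone⇒span₊ {S = C ∩ F} (μ∈C , μ∈F) (ν∈C , ν∈F) (span₊⇒cone γ∈μν)
            , cone⇒span₊ {S = G ∖ (C ∩ F)} ((α∈F , proj₁ α∈D) , proj₂ α∈D ∘ proj₁)
                ((β∈F , β∈P) , β∉C ∘ proj₁) (span₊⇒cone γ∈αβ)))
          where
          β∈F : β ∈ F
          β∈F = proj₁ (proj₂ (full α∈F γ∈F) (segment⊆X β∈P , β∈αγ))

        conclude : ¬ Cone α β γ
        conclude (x , y , x≥0 , y≥0 , γ≈) with decide {y ≈ 0#}
        ... | no y≉0  = separate β∈D γ∈αβ (span-solveʳ γ≈ y≉0)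
        ... | yes y≈0 = separate α∈D (∈-ray x≥0 (≈ᴹ-trans γ≈
                (≈ᴹ-trans (+ᴹ-congˡ (x≈0⇒x*y≈0 y≈0)) (+ᴹ-identityʳ _))))
                (span₊⇒span {S = ⟅ α , γ ⟆} (∈-pair ≈ᴹ-refl))

      extend-new : ∀ {n E} → BiclosedIn (segment n) E →
        (∀ {γ α β} → γ ∈ New n → α ∈ segment n ∖ E → β ∈ segment n ∖ E → γ ∉ Span₊ ⟅ α , β ⟆) →
        ClosedIn (segment (ℕ.suc n)) (E ∪ New n)
      extend-new {n} {E} bi apart α∈ β∈ (ε∈αβ , ε∈) with proj₁ segment-suc ε∈
      ... | inj₂ ε∈N = inj₂ ε∈N
      ... | inj₁ ε∈P = inj₁ (stable λ ε∉E → go (ε∈P , ε∉E) α∈ β∈ ε∈αβ)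
        where
        open BiclosedIn bi
        mixed : ∀ {ε γ δ} → ε ∈ segment n ∖ E → γ ∈ New n → δ ∈ E → ε ∉ Span₊ ⟅ γ , δ ⟆
        mixed ε∈D@(ε∈P , ε∉E) γ∈N δ∈E ε∈γδ with exchange γ∈N (contained δ∈E) ε∈P ε∈γδ
        ... | inj₁ γ∈εε = apart γ∈N ε∈D ε∈D γ∈εε
        ... | inj₂ (inj₁ ε∈δδ) = ε∉E (closed δ∈E δ∈E (ε∈δδ , ε∈P))
        ... | inj₂ (inj₂ (α , α∈P , γ∈αε , ε∈αδ)) =
          apart γ∈N (α∈P , λ α∈E → ε∉E (closed α∈E δ∈E (ε∈αδ , ε∈P))) ε∈D γ∈αε

        go : ∀ {ε α β} → ε ∈ segment n ∖ E → α ∈ E ∪ New n → β ∈ E ∪ New n → ε ∉ Span₊ ⟅ α , β ⟆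
        go (ε∈P , ε∉E) (inj₁ α∈E) (inj₁ β∈E) ε∈αβ = ε∉E (closed α∈E β∈E (ε∈αβ , ε∈P))
        go ε∈D (inj₁ α∈E) (inj₂ β∈N) ε∈αβ = mixed ε∈D β∈N α∈E (pair-swap ε∈αβ)
        go ε∈D (inj₂ α∈N) (inj₁ β∈E) ε∈αβ = mixed ε∈D α∈N β∈E ε∈αβ
        go ε∈D@(ε∈P , _) (inj₂ α∈N) (inj₂ β∈N) ε∈αβ = apart α∈N ε∈D ε∈D
          (ray-swap (0∉X (segment⊆X ε∈P)) (pair-congʳ (new-unique β∈N α∈N) ε∈αβ))

      extend-old : ∀ {n} {E : Pred Carrierᴹ ℓ} → E ⊆ segment n → ClosedIn (segment n) E →
        (∀ {γ α β} → γ ∈ New n → α ∈ E → β ∈ E → γ ∉ Span₊ ⟅ α , β ⟆) →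
        ClosedIn (segment (ℕ.suc n)) E
      extend-old E⊆P closed apart α∈E β∈E (γ∈αβ , γ∈) with proj₁ segment-suc γ∈
      ... | inj₁ γ∈P = closed α∈E β∈E (γ∈αβ , γ∈P)
      ... | inj₂ γ∈N = ⊥-elim (apart γ∈N α∈E β∈E γ∈αβ)

      module _ {A : Pred Carrierᴹ ℓ} (A⊆X : A ⊆ X) (A-coclosed : ClosedIn X (X ∖ A)) where

        Generated : Pred Carrierᴹ ℓ → Pred Carrierᴹ ℓ
        Generated C x = x ∈ A ⊎ ∃[ μ ] ∃[ ν ] μ ∈ C × ν ∈ C × x ∈ Span₊ ⟅ μ , ν ⟆

        Stage : ℕ → Pred Carrierᴹ ℓ
        Stage ℕ.zero      = λ _ → ⊥ {ℓ}
        Stage (ℕ.suc n) = Stage n ∪ (New n ∩ Generated (Stage n))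

        stage⊆closure : ∀ n → Stage n ⊆ Closure X A
        stage⊆closure (ℕ.suc n) (inj₁ x∈) = stage⊆closure n x∈
        stage⊆closure (ℕ.suc n) (inj₂ (_ , inj₁ x∈A)) = include x∈A
        stage⊆closure (ℕ.suc n) (inj₂ (x∈N , inj₂ (μ , ν , μ∈ , ν∈ , x∈μν))) =
          generate (stage⊆closure n μ∈) (stage⊆closure n ν∈) x∈μν (new⊆X x∈N)

        stage⊇ : ∀ n → A ∩ segment n ⊆ Stage n
        stage⊇ (ℕ.suc n) (x∈A , x∈) with proj₁ segment-suc x∈
        ... | inj₁ x∈P = inj₁ (stage⊇ n (x∈A , x∈P))
        ... | inj₂ x∈N = inj₂ (x∈N , inj₁ x∈A)

        stage⊆segment : ∀ n → Stage n ⊆ segment n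
        stage⊆segment (ℕ.suc n) (inj₁ x∈)        = proj₂ segment-suc (inj₁ (stage⊆segment n x∈))
        stage⊆segment (ℕ.suc n) (inj₂ (x∈N , _)) = proj₂ segment-suc (inj₂ x∈N)

        stage-mono : ∀ {m n} → m ℕ.≤′ n → Stage m ⊆ Stage n
        stage-mono ℕ.≤′-refl      x∈ = x∈
        stage-mono (ℕ.≤′-step le) x∈ = inj₁ (stage-mono le x∈)

        generated-apart : ∀ {n γ α β} → BiclosedIn (segment n) (Stage n) →
          γ ∈ New n → γ ∈ Generated (Stage n) →
          α ∈ segment n ∖ Stage n → β ∈ segment n ∖ Stage n → γ ∉ Span₊ ⟅ α , β ⟆
        generated-apart {n} bi γ∈N (inj₁ γ∈A) (α∈P , α∉) (β∈P , β∉) γ∈αβ =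
          proj₂ (A-coclosed (segment⊆X α∈P , λ α∈A → α∉ (stage⊇ n (α∈A , α∈P)))
                            (segment⊆X β∈P , λ β∈A → β∉ (stage⊇ n (β∈A , β∈P)))
                            (γ∈αβ , new⊆X γ∈N)) γ∈A
        generated-apart bi γ∈N (inj₂ (μ , ν , μ∈ , ν∈ , γ∈μν)) = new-not-both bi γ∈N μ∈ ν∈ γ∈μν

        generated-resp : ∀ {C} → Generated C Respects _≈ᴹ_
        generated-resp x≈y (inj₁ x∈A) = inj₁ (coclosed-resp A⊆X A-coclosed x≈y x∈A)
        generated-resp x≈y (inj₂ (μ , ν , μ∈ , ν∈ , n , k , v , k≥0 , v∈ , e)) =
          inj₂ (μ , ν , μ∈ , ν∈ , n , k , v , k≥0 , v∈ , ≈ᴹ-trans (≈ᴹ-sym x≈y) e)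

        stage-biclosed : ∀ n → BiclosedIn (segment n) (Stage n)
        stage-biclosed ℕ.zero = record
          { contained = λ ()
          ; closed    = λ ()
          ; coclosed  = λ { ((_ , _ , ()) , _) }
          }
        stage-biclosed (ℕ.suc n)
          with stage-biclosed n | decide {∃[ γ ] γ ∈ New n ∩ Generated (Stage n)}
        ... | bi | yes (γ , γ∈N , γ∈G) = record
          { contained = stage⊆segment (ℕ.suc n)
          ; closed    = closedIn-resp-≐ {B = Stage n ∪ New n}
              ([ inj₁ , (λ x∈N → inj₂ (x∈N , generated x∈N)) ]′ , [ inj₁ , inj₂ ∘ proj₁ ]′)
              (extend-new bi apart)
          ; coclosed  = closedIn-resp-≐ {B = segment n ∖ Stage n}
              ((λ (x∈P , x∉) → proj₂ segment-suc (inj₁ x∈P) ,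
                 [ x∉ , (λ (x∈N , _) → new≉segment x∈N x∈P ≈ᴹ-refl) ]′) ,
               λ (x∈ , x∉) → [ (λ x∈P → x∈P , x∉ ∘ inj₁) ,
                 (λ x∈N → ⊥-elim (x∉ (inj₂ (x∈N , generated x∈N)))) ]′ (proj₁ segment-suc x∈))
              (extend-old proj₁ (BiclosedIn.coclosed bi) apart)
          }
          where
          generated : New n ⊆ Generated (Stage n)
          generated x∈N = generated-resp (new-unique γ∈N x∈N) γ∈G
          apart : ∀ {γ α β} → γ ∈ New n → α ∈ segment n ∖ Stage n → β ∈ segment n ∖ Stage n →
                  γ ∉ Span₊ ⟅ α , β ⟆
          apart γ∈N = generated-apart bi γ∈N (generated γ∈N)
        ... | bi | no none = record
          { contained = stage⊆segment (ℕ.suc n)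
          ; closed    = closedIn-resp-≐ {B = Stage n}
              (inj₁ , [ id , (λ x∈ → ⊥-elim (none (_ , x∈))) ]′)
              (extend-old contained closed apart)
          ; coclosed  = closedIn-resp-≐ {B = (segment n ∖ Stage n) ∪ New n}
              ([ (λ (x∈P , x∉) → proj₂ segment-suc (inj₁ x∈P) ,
                   [ x∉ , (λ x∈ → none (_ , x∈)) ]′) ,
                 (λ x∈N → proj₂ segment-suc (inj₂ x∈N) ,
                   [ (λ x∈ → new≉segment x∈N (contained x∈) ≈ᴹ-refl) ,
                     (λ x∈ → none (_ , x∈)) ]′) ]′ ,
               λ (x∈ , x∉) → [ (λ x∈P → inj₁ (x∈P , x∉ ∘ inj₁)) , inj₂ ]′ (proj₁ segment-suc x∈))
              (extend-new (complement-biclosed bi)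
                λ γ∈N α∈ β∈ → apart γ∈N (restore α∈) (restore β∈))
          }
          where
          open BiclosedIn bi
          apart : ∀ {γ α β} → γ ∈ New n → α ∈ Stage n → β ∈ Stage n → γ ∉ Span₊ ⟅ α , β ⟆
          apart γ∈N α∈ β∈ γ∈αβ = none (_ , γ∈N , inj₂ (_ , _ , α∈ , β∈ , γ∈αβ))
          restore : segment n ∖ (segment n ∖ Stage n) ⊆ Stage n
          restore (x∈P , x∉) = stable λ x∉S → x∉ (x∈P , x∉S)

        closure-coclosed : ClosedIn X (X ∖ Closure X A)
        closure-coclosed {α} {β} {γ} (α∈X , α∉) (β∈X , β∉) (γ∈αβ , γ∈X) = γ∈X , λ γ∈ →
          let a , α∈a = covers α∈X
              b , β∈b = covers β∈X
              c , γ∈c = closure⊆stages γ∈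
              n = (a ℕ.⊔ b) ℕ.⊔ c
              a≤n = ℕ.≤-trans (ℕ.m≤m⊔n a b) (ℕ.m≤m⊔n (a ℕ.⊔ b) c)
              b≤n = ℕ.≤-trans (ℕ.m≤n⊔m a b) (ℕ.m≤m⊔n (a ℕ.⊔ b) c)
              γ∈n = stage-≤ (ℕ.m≤n⊔m (a ℕ.⊔ b) c) γ∈c
          in proj₂ (BiclosedIn.coclosed (stage-biclosed n)
               (segment-mono a≤n α∈a , λ α∈n → α∉ (stage⊆closure n α∈n))
               (segment-mono b≤n β∈b , λ β∈n → β∉ (stage⊆closure n β∈n))
               (γ∈αβ , stage⊆segment n γ∈n)) γ∈n
          where
          covers : ∀ {x} → x ∈ X → ∃[ n ] x ∈ segment n
          covers x∈X with surjective x∈X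
          ... | i , e = ℕ.suc (position i) , i , e , ℕ.≤-refl

          segment-mono : ∀ {m n} → m ℕ.≤ n → segment m ⊆ segment n
          segment-mono m≤n (i , e , i<m) = i , e , ℕ.≤-trans i<m m≤n

          stage-≤ : ∀ {m n} → m ℕ.≤ n → Stage m ⊆ Stage n
          stage-≤ m≤n = stage-mono (ℕ.≤⇒≤′ m≤n)

          Stages : Pred Carrierᴹ ℓ
          Stages x = ∃[ n ] x ∈ Stage n

          stages-closed : ClosedIn X Stages
          stages-closed (a , α∈a) (b , β∈b) (γ∈αβ , γ∈X) =
            let c , γ∈c = covers γ∈X
                n = (a ℕ.⊔ b) ℕ.⊔ c
                a≤n = ℕ.≤-trans (ℕ.m≤m⊔n a b) (ℕ.m≤m⊔n (a ℕ.⊔ b) c)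
                b≤n = ℕ.≤-trans (ℕ.m≤n⊔m a b) (ℕ.m≤m⊔n (a ℕ.⊔ b) c)
            in n , BiclosedIn.closed (stage-biclosed n) (stage-≤ a≤n α∈a) (stage-≤ b≤n β∈b)
                 (γ∈αβ , segment-mono (ℕ.m≤n⊔m (a ℕ.⊔ b) c) γ∈c)

          closure⊆stages : Closure X A ⊆ Stages
          closure⊆stages = closure-least X A Stages
            (λ x∈A → let n , x∈n = covers (A⊆X x∈A) in n , stage⊇ n (x∈A , x∈n)) stages-closed

    module Lattice (fundamental : HasAllFundamentalVectors X)
                   (order : Ordering X) (suitable : Suitable X order) where

      -- Excluded middle makes every predicate equivalent to one of level ℓ, as BiclosedIn requires.
      record Resize (P : Pred Carrierᴹ (suc ℓ)) (x : Carrierᴹ) : Set ℓ where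
        constructor resize
        field witness : True (em {P x})

      resize⁺ : ∀ {P} → P ⊆ Resize P
      resize⁺ x∈P = resize (fromWitness x∈P)

      resize⁻ : ∀ {P} → Resize P ⊆ P
      resize⁻ (resize w) = toWitness w

      Join : Pred (BiclosedSubset X) (suc ℓ) → Pred Carrierᴹ ℓ
      Join 𝒳 = Closure X (Resize (Union X 𝒳))

      union-least : ∀ 𝒳 (Z : Pred Carrierᴹ ℓ) → (∀ Y → Y ∈ 𝒳 → ⟦_⟧ X Y ⊆ Z) →
                    Resize (Union X 𝒳) ⊆ Z
      union-least 𝒳 Z upper x∈ = let Y , Y∈𝒳 , x∈Y = resize⁻ x∈ in upper Y Y∈𝒳 x∈Y

      union⊆X : ∀ 𝒳 → Resize (Union X 𝒳) ⊆ X
      union⊆X 𝒳 = union-least 𝒳 X λ Y _ → BiclosedIn.contained (proj₂ Y)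

      union-coclosed : ∀ 𝒳 → ClosedIn X (X ∖ Resize (Union X 𝒳))
      union-coclosed 𝒳 (α∈X , α∉) (β∈X , β∉) γ∈@(_ , γ∈X) = γ∈X , λ γ∈∪ →
        let Y , Y∈𝒳 , γ∈Y = resize⁻ γ∈∪
        in proj₂ (BiclosedIn.coclosed (proj₂ Y)
             (α∈X , λ α∈Y → α∉ (resize⁺ (Y , Y∈𝒳 , α∈Y)))
             (β∈X , λ β∈Y → β∉ (resize⁺ (Y , Y∈𝒳 , β∈Y))) γ∈) γ∈Y

      -- If 0 ∈ X, then every biclosed set is ∅ or X, since a nonempty closed set contains 0.
      join-coclosed : ∀ 𝒳 → ClosedIn X (X ∖ Join 𝒳)
      join-coclosed 𝒳 α∈ β∈ γ∈ with decide {∃[ x ] x ∈ X × x ≈ᴹ 0ᴹ}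
      ... | no 0∉X = closure-coclosed (λ x∈X x≈0 → 0∉X (_ , x∈X , x≈0)) fundamental order suitable
              (union⊆X 𝒳) (union-coclosed 𝒳) α∈ β∈ γ∈
      ... | yes (o , o∈X , o≈0) = proj₂ γ∈ , λ γ∈Join →
        let a , a∈∪ = closure-least X A (λ _ → ∃ A) (_ ,_) (λ p _ _ → p) γ∈Join
            Y , Y∈𝒳 , a∈Y = resize⁻ a∈∪
            o∈Y = BiclosedIn.closed (proj₂ Y) a∈Y a∈Y (o∈ray a , o∈X)
            α∉Y = λ α∈Y → proj₂ α∈ (include (resize⁺ (Y , Y∈𝒳 , α∈Y)))
            α∈X∖Y = proj₁ α∈ , α∉Y
        in proj₂ (BiclosedIn.coclosed (proj₂ Y) α∈X∖Y α∈X∖Y (o∈ray _ , o∈X)) o∈Y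
        where
        A = Resize (Union X 𝒳)
        o∈ray : ∀ x → o ∈ Span₊ ⟅ x , x ⟆
        o∈ray x = ∈-ray ≤-refl (≈ᴹ-trans o≈0 (≈ᴹ-sym (*ₗ-zeroˡ x)))

      join-biclosed : ∀ 𝒳 → BiclosedIn X (Join 𝒳)
      join-biclosed 𝒳 = record
        { contained = closure-least X _ X (union⊆X 𝒳) (λ _ _ → proj₂)
        ; closed    = closure-closed X _
        ; coclosed  = join-coclosed 𝒳
        }

      join-isJoin : ∀ 𝒳 → IsJoin (biclosedPoset X) 𝒳 (Join 𝒳 , join-biclosed 𝒳)
      join-isJoin 𝒳 =
        (λ Y Y∈𝒳 y∈Y → include (resize⁺ (Y , Y∈𝒳 , y∈Y))) ,
        λ Z upper →
          closure-least X _ _ (union-least 𝒳 (proj₁ Z) upper) (BiclosedIn.closed (proj₂ Z))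

      join≐closure : ∀ 𝒳 → Join 𝒳 ≐ Closure X (Union X 𝒳)
      join≐closure 𝒳 =
        closure-least X _ _ (include ∘ resize⁻) (closure-closed X _) ,
        closure-least X _ _ (include ∘ resize⁺) (closure-closed X _)

      Complements : Pred (BiclosedSubset X) (suc ℓ) → Pred (BiclosedSubset X) (suc ℓ)
      Complements 𝒳 Z = ∃[ Y ] Y ∈ 𝒳 × ⟦_⟧ X Z ≐ X ∖ ⟦_⟧ X Y

      complement : BiclosedSubset X → BiclosedSubset X
      complement (B , bi) = X ∖ B , complement-biclosed bi

      Meet : Pred (BiclosedSubset X) (suc ℓ) → BiclosedSubset X
      Meet 𝒳 = complement (Join (Complements 𝒳) , join-biclosed (Complements 𝒳))

      meet-isMeet : ∀ 𝒳 → IsMeet (biclosedPoset X) 𝒳 (Meet 𝒳)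
      meet-isMeet 𝒳 =
        (λ Y Y∈𝒳 (x∈X , x∉) → stable λ x∉Y →
          x∉ (proj₁ (join-isJoin (Complements 𝒳)) (complement Y) (Y , Y∈𝒳 , ≐-refl) (x∈X , x∉Y))) ,
        λ Z lower {z} z∈Z → BiclosedIn.contained (proj₂ Z) z∈Z , λ z∈Join →
          proj₂ (proj₂ (join-isJoin (Complements 𝒳)) (complement Z)
            (λ W (Y , Y∈𝒳 , W⊆ , _) w∈W →
              let w∈X , w∉Y = W⊆ w∈W in w∈X , λ w∈Z → w∉Y (lower Y Y∈𝒳 w∈Z)) z∈Join) z∈Z

      complements-union : ∀ 𝒳 → Union X (Complements 𝒳) ≐ X ∖ Intersection X 𝒳
      complements-union 𝒳 =
        (λ (Z , (Y , Y∈𝒳 , Z⊆ , _) , x∈Z) →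
          let x∈X , x∉Y = Z⊆ x∈Z in x∈X , λ (_ , x∈all) → x∉Y (x∈all Y Y∈𝒳)) ,
        λ (x∈X , x∉) → decidable-stable em λ x∉∪ → x∉ (x∈X , λ Y Y∈𝒳 → stable λ x∉Y →
          x∉∪ (complement Y , (Y , Y∈𝒳 , ≐-refl) , x∈X , x∉Y))

      meet≐interior : ∀ 𝒳 → ⟦_⟧ X (Meet 𝒳) ≐ Interior X (Intersection X 𝒳)
      meet≐interior 𝒳 =
        (λ (x∈X , x∉) → x∈X , λ x∈ → x∉ (proj₂ (join≐closure _)
          (closure-least X _ _ (include ∘ proj₂ (complements-union 𝒳)) (closure-closed X _) x∈))) ,
        λ (x∈X , x∉) → x∈X , λ x∈ → x∉
          (closure-least X _ _ (include ∘ proj₁ (complements-union 𝒳)) (closure-closed X _)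
            (proj₁ (join≐closure _) x∈))

theorem4p1 : ∀ {ℓ} → ExcludedMiddle (suc ℓ) →
    (ℝ : RealField ℓ) (V : VectorSpace ℝ) →
    let open Module V
        open Geometry ℝ V
    in
    FiniteDimensional →
    (X : Pred Carrierᴹ ℓ) → X Respects _≈ᴹ_ →
    HasAllFundamentalVectors X →
    (order : Ordering X) → Suitable X order →
    IsCompleteLattice (biclosedPoset X) ×
    (∀ (𝒳 : Pred (BiclosedSubset X) (suc ℓ)) →
      (∀ J → IsJoin (biclosedPoset X) 𝒳 J →
        ⟦_⟧ X J ≐ Closure X (Union X 𝒳)) ×
      (∀ M → IsMeet (biclosedPoset X) 𝒳 M →
        ⟦_⟧ X M ≐ Interior X (Intersection X 𝒳)))
theorem4p1 em ℝ V _ X X-resp fundamental order suitable =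
  (λ 𝒳 → ((Join 𝒳 , join-biclosed 𝒳) , join-isJoin 𝒳) , (Meet 𝒳 , meet-isMeet 𝒳)) ,
  λ 𝒳 →
    (λ J (upper , least) →
      (λ x∈J → proj₁ (join≐closure 𝒳)
        (least (Join 𝒳 , join-biclosed 𝒳) (proj₁ (join-isJoin 𝒳)) x∈J)) ,
      λ x∈ → proj₂ (join-isJoin 𝒳) J upper (proj₂ (join≐closure 𝒳) x∈)) ,
    λ M (lower , greatest) →
      (λ x∈M → proj₁ (meet≐interior 𝒳) (proj₂ (meet-isMeet 𝒳) M lower x∈M)) ,
      λ x∈ → greatest (Meet 𝒳) (proj₁ (meet-isMeet 𝒳)) (proj₂ (meet≐interior 𝒳) x∈)
  where
  open Biclosed.Lattice em ℝ V X X-resp fundamental order suitable
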